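{- For all integers $n\geq 1$ and $k\geq 2$, $$f(n,k)\geq n+\frac{(k-1)(n-1)(n+2)}{2}.$$
   Context: All graphs are finite, simple and undirected. For integers $n\geq 1$ and $k\geq 2$, $f(n,k)$ denotes the maximal integer $f$ with the following property: if a graph $G=(V,E)$ contains no odd cycles of length at most $2k-1$ and $|V|\leq f$, then $G$ has a proper vertex coloring in $n$ colors. In particular $f(1,k)=1$. -}

module Defs where

open import Data.Fin.Base as Fin using (Fin; zero; suc; toℕ; fromℕ<; finToFun; funToFin)
open import Data.Fin.Properties as Fin
  using (all?; any?; finToFun-funToFin; toℕ-fromℕ<; pigeonhole)
open import Data.Nat.Base
open import Data.Nat.Divisibility using (_∣_; _∣?_; divides; ∣m∣n⇒∣m+n; ∣m+n∣m⇒∣n; ∣-refl)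
open import Data.Nat.Properties
open import Data.Nat.Tactic.RingSolver using (solve-∀)
open import Data.Product.Base using (∃; _×_; _,_; proj₁; proj₂)
open import Data.Sum.Base using (_⊎_; inj₁; inj₂)
open import Function.Base using (_∘_)
open import Function.Definitions using (Injective)
open import Level using (0ℓ)
open import Relation.Binary.Core using (Rel)
open import Relation.Binary.Definitions
  using (Decidable; Symmetric; Irreflexive; tri<; tri≈; tri>)
open import Relation.Binary.PropositionalEquality
  using (_≡_; _≢_; refl; sym; trans; cong; subst; subst₂)
open import Relation.Nullary using (¬_; Dec; yes; no; contradiction)
open import Relation.Nullary.Decidable using (map′; ¬?; _×-dec_; _⊎-dec_; _→-dec_)

record Graph (v : ℕ) : Set₁ where
  infix 4 _~_
  field
    _~_      : Rel (Fin v) 0ℓ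
    _~?_     : Decidable _~_
    ~-sym    : Symmetric _~_
    ~-irrefl : Irreflexive _≡_ _~_

open Graph using (_~?_; ~-sym; ~-irrefl)

Colourable : ∀ {v} → ℕ → Graph v → Set
Colourable {v} n G = ∃ λ (c : Fin v → Fin n) → ∀ x y → x ~ y → c x ≢ c y
  where open Graph G using (_~_)

record Cycle {v : ℕ} (G : Graph v) (ℓ : ℕ) : Set where
  open Graph G using (_~_)
  field
    3≤ℓ       : 3 ≤ ℓ
    vertex    : Fin ℓ → Fin v
    injective : Injective _≡_ _≡_ vertex
    step      : ∀ i j → toℕ j ≡ suc (toℕ i) → vertex i ~ vertex j
    closed    : ∀ i j → suc (toℕ i) ≡ ℓ → toℕ j ≡ 0 → vertex i ~ vertex j

NoShortOddCycle : ∀ {v} → ℕ → Graph v → Set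
NoShortOddCycle k G = ∀ ℓ → ℓ ≤ 2 * k ∸ 1 → ¬ 2 ∣ ℓ → ¬ Cycle G ℓ

ColourableUpTo : ℕ → ℕ → ℕ → Set₁
ColourableUpTo n k m =
  ∀ v → v ≤ m → (G : Graph v) → NoShortOddCycle k G → Colourable n G

IsMaximum : ∀ {a} → (ℕ → Set a) → ℕ → Set a
IsMaximum P m = P m × (∀ m′ → P m′ → m′ ≤ m)

-- The maximum defining f n k exists: ColourableUpTo n k is decidable, since
-- there are finitely many graphs of each order up to isomorphism, and it fails
-- for some order, by the iterated shift graphs constructed below.

module Decision where

  anyFun? : ∀ {m n} {P : (Fin m → Fin n) → Set} →
            (∀ {g h} → (∀ i → g i ≡ h i) → P g → P h) →
            (∀ g → Dec (P g)) → Dec (∃ P)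
  anyFun? resp P? = map′
    (λ (i , p) → finToFun i , p)
    (λ (g , p) → funToFin g , resp (sym ∘ finToFun-funToFin g) p)
    (any? (P? ∘ finToFun))

  colourable? : ∀ {v} n (G : Graph v) → Dec (Colourable n G)
  colourable? n G = anyFun?
    (λ e p x y x~y → subst₂ _≢_ (e x) (e y) (p x y x~y))
    (λ c → all? λ x → all? λ y → (G ~? x) y →-dec ¬? (c x Fin.≟ c y))

  cycle? : ∀ {v} (G : Graph v) ℓ → Dec (Cycle G ℓ)
  cycle? {v} G ℓ = map′
    (λ (c , a , i , s , t) → record
      { 3≤ℓ = a ; vertex = c ; injective = λ {x} {y} → i x y ; step = s ; closed = t })
    (λ C → let open Cycle C in
      vertex , 3≤ℓ , (λ x y → injective {x} {y}) , step , closed)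
    (anyFun? resp λ c →
      (3 ≤? ℓ)
      ×-dec (all? λ x → all? λ y → (c x Fin.≟ c y) →-dec (x Fin.≟ y))
      ×-dec (all? λ i → all? λ j → (toℕ j ≟ suc (toℕ i)) →-dec (G ~? c i) (c j))
      ×-dec (all? λ i → all? λ j →
              (suc (toℕ i) ≟ ℓ) →-dec ((toℕ j ≟ 0) →-dec (G ~? c i) (c j))))
    where
    open Graph G using (_~_)
    IsCycle : (Fin ℓ → Fin v) → Set
    IsCycle c = 3 ≤ ℓ
      × (∀ x y → c x ≡ c y → x ≡ y)
      × (∀ i j → toℕ j ≡ suc (toℕ i) → c i ~ c j)
      × (∀ i j → suc (toℕ i) ≡ ℓ → toℕ j ≡ 0 → c i ~ c j)
    resp : ∀ {g h} → (∀ i → g i ≡ h i) → IsCycle g → IsCycle h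
    resp e (a , i , s , t) =
        a
      , (λ x y q → i x y (trans (e x) (trans q (sym (e y)))))
      , (λ x y q → subst₂ _~_ (e x) (e y) (s x y q))
      , (λ x y q r → subst₂ _~_ (e x) (e y) (t x y q r))

  noShortOddCycle? : ∀ {v} k (G : Graph v) → Dec (NoShortOddCycle k G)
  noShortOddCycle? k G = map′
    (λ h ℓ ℓ≤ → h (s≤s ℓ≤))
    (λ h {ℓ} ℓ< → h ℓ (≤-pred ℓ<))
    (allUpTo? (λ ℓ → ¬? (2 ∣? ℓ) →-dec ¬? (cycle? G ℓ)) (suc (2 * k ∸ 1)))

  Code : ℕ → Set
  Code v = Fin ((2 ^ v) ^ v)

  entry : ∀ {v} → Code v → Fin v → Fin v → Fin 2
  entry {v} M x y = finToFun {2} {v} (finToFun {2 ^ v} {v} M x) y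

  fromCode : ∀ {v} → Code v → Graph v
  fromCode {v} M = record
    { _~_      = λ x y → x ≢ y × entry {v} M x y ≡ suc zero × entry {v} M y x ≡ suc zero
    ; _~?_     = λ x y → ¬? (x Fin.≟ y) ×-dec (entry {v} M x y Fin.≟ suc zero)
                                        ×-dec (entry {v} M y x Fin.≟ suc zero)
    ; ~-sym    = λ (a , b , c) → a ∘ sym , c , b
    ; ~-irrefl = λ e (a , _) → a e
    }

  bit : ∀ {A : Set} → Dec A → Fin 2
  bit (yes _) = suc zero
  bit (no _)  = zero

  bit⁺ : ∀ {A : Set} (d : Dec A) → A → bit d ≡ suc zero
  bit⁺ (yes _) a = refl
  bit⁺ (no ¬a) a = contradiction a ¬a

  bit⁻ : ∀ {A : Set} (d : Dec A) → bit d ≡ suc zero → A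
  bit⁻ (yes a) _ = a

  toCode : ∀ {v} → Graph v → Code v
  toCode G = funToFin λ x → funToFin λ y → bit ((G ~? x) y)

  entry-toCode : ∀ {v} (G : Graph v) x y → entry {v} (toCode G) x y ≡ bit ((G ~? x) y)
  entry-toCode G x y =
    trans (cong (λ r → finToFun r y) (finToFun-funToFin (λ x → funToFin λ y → bit ((G ~? x) y)) x))
          (finToFun-funToFin (λ y → bit ((G ~? x) y)) y)

  module _ {v} (G : Graph v) where
    open Graph G using (_~_)
    open Graph (fromCode {v} (toCode G)) using () renaming (_~_ to _~′_)

    ~⇒~′ : ∀ {x y} → x ~ y → x ~′ y
    ~⇒~′ {x} {y} e = (λ x≡y → ~-irrefl G x≡y e)
      , trans (entry-toCode G x y) (bit⁺ _ e)
      , trans (entry-toCode G y x) (bit⁺ _ (~-sym G e))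

    ~′⇒~ : ∀ {x y} → x ~′ y → x ~ y
    ~′⇒~ {x} {y} (_ , e , _) = bit⁻ _ (trans (sym (entry-toCode G x y)) e)

  Good : ℕ → ℕ → ℕ → Set₁
  Good n k v = (G : Graph v) → NoShortOddCycle k G → Colourable n G

  good? : ∀ n k v → Dec (Good n k v)
  good? n k v = map′ to (λ h M → h (fromCode {v} M))
    (all? λ M → noShortOddCycle? k (fromCode {v} M) →-dec colourable? n (fromCode {v} M))
    where
    to : (∀ (M : Code v) → NoShortOddCycle k (fromCode {v} M) →
                          Colourable n (fromCode {v} M)) → Good n k v
    to h G noc = let c , p = h (toCode G) noc′ in c , λ x y e → p x y (~⇒~′ G e)
      where
      noc′ : NoShortOddCycle k (fromCode {v} (toCode G))
      noc′ ℓ ℓ≤ odd C = noc ℓ ℓ≤ odd record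
        { 3≤ℓ = 3≤ℓ ; vertex = vertex ; injective = injective
        ; step = λ i j e → ~′⇒~ G (step i j e)
        ; closed = λ i j e e′ → ~′⇒~ G (closed i j e e′) }
        where open Cycle C

  colourableUpTo? : ∀ n k m → Dec (ColourableUpTo n k m)
  colourableUpTo? n k m = map′
    (λ h v v≤ → h (s≤s v≤)) (λ h {v} v< → h v (≤-pred v<))
    (allUpTo? (good? n k) (suc m))

module Shift where

  -- Arc a b says that a and b are the initial and the final segment of one
  -- strictly increasing sequence of length K + 1 (for K = 1 the clause a i < b i
  -- is what expresses this).
  Increasing : ∀ {K N} → (Fin K → Fin N) → Set
  Increasing a = ∀ i j → i Fin.< j → a i Fin.< a j

  Arc : ∀ {K N} → (Fin K → Fin N) → (Fin K → Fin N) → Set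
  Arc a b = Increasing a × Increasing b
    × (∀ i j → toℕ i ≡ suc (toℕ j) → a i ≡ b j)
    × (∀ i → a i Fin.< b i)

  increasing? : ∀ {K N} (a : Fin K → Fin N) → Dec (Increasing a)
  increasing? a = all? λ i → all? λ j → (i Fin.<? j) →-dec (a i Fin.<? a j)

  arc? : ∀ {K N} (a b : Fin K → Fin N) → Dec (Arc a b)
  arc? a b = increasing? a ×-dec increasing? b
    ×-dec (all? λ i → all? λ j → (toℕ i ≟ suc (toℕ j)) →-dec (a i Fin.≟ b j))
    ×-dec (all? λ i → a i Fin.<? b i)

  arc-resp : ∀ {K N} {a a′ b b′ : Fin K → Fin N} →
             (∀ i → a i ≡ a′ i) → (∀ i → b i ≡ b′ i) → Arc a b → Arc a′ b′
  arc-resp e e′ (p , q , r , s) =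
      (λ i j i<j → subst₂ Fin._<_ (e i) (e j) (p i j i<j))
    , (λ i j i<j → subst₂ Fin._<_ (e′ i) (e′ j) (q i j i<j))
    , (λ i j eq → trans (sym (e i)) (trans (r i j eq) (e′ j)))
    , (λ i → subst₂ Fin._<_ (e i) (e′ i) (s i))

  infixr 5 _∷_
  _∷_ : ∀ {K N} → Fin N → (Fin K → Fin N) → Fin (suc K) → Fin N
  (z ∷ a) zero    = z
  (z ∷ a) (suc i) = a i

  ∷-increasing : ∀ {K N} z (a : Fin (suc K) → Fin N) →
                 z Fin.< a zero → Increasing a → Increasing (z ∷ a)
  ∷-increasing z a z< inc zero    (suc zero)    _         = z<
  ∷-increasing z a z< inc zero    (suc (suc j)) _         = <-trans z< (inc zero (suc j) z<s)
  ∷-increasing z a z< inc (suc i) (suc j)       (s<s i<j) = inc i j i<j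

  ∷-arc : ∀ {K N} z (a b : Fin (suc K) → Fin N) → z Fin.< a zero →
          Arc a b → Arc (z ∷ a) (a zero ∷ b)
  ∷-arc z a b z< (p , q , r , s) =
      ∷-increasing z a z< p
    , ∷-increasing (a zero) b (s zero) q
    , (λ { (suc zero)    zero    _  → refl
         ; (suc (suc i)) zero    ()
         ; (suc i)       (suc j) eq → r i j (suc-injective eq) })
    , (λ { zero → z< ; (suc i) → s i })

  ProperColouring : ∀ {K N n} → ((Fin K → Fin N) → Fin n) → Set
  ProperColouring c = ∀ a b → Arc a b → c a ≢ c b

  tower : ℕ → ℕ → ℕ
  tower zero    n = n
  tower (suc K) n = tower K (2 ^ n)

  -- Colouring b by the set of colours of its extensions z ∷ b with z < b zero
  -- turns an n-colouring of (K + 1)-tuples into a 2 ^ n-colouring of K-tuples.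
  uncolourable : ∀ K {n N} → tower K n < N →
                 (c : (Fin (suc K) → Fin N) → Fin n) → ¬ ProperColouring c
  uncolourable zero n<N c proper =
    let i , j , i<j , eq = pigeonhole n<N (λ x → c (λ _ → x)) in
    proper (λ _ → i) (λ _ → j)
      ( (λ { zero zero () }) , (λ { zero zero () })
      , (λ { zero zero () }) , (λ _ → i<j)) eq
  uncolourable (suc K) {n} {N} t<N c proper = uncolourable K t<N c′ proper′
    where
    Reaches : (Fin (suc K) → Fin N) → Fin n → Set
    Reaches b γ = ∃ λ z → z Fin.< b zero × c (z ∷ b) ≡ γ

    reaches? : ∀ b γ → Dec (Reaches b γ)
    reaches? b γ = any? λ z → (z Fin.<? b zero) ×-dec (c (z ∷ b) Fin.≟ γ)

    bits : (Fin (suc K) → Fin N) → Fin n → Fin 2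
    bits b γ = Decision.bit (reaches? b γ)

    c′ : (Fin (suc K) → Fin N) → Fin (2 ^ n)
    c′ b = funToFin (bits b)

    proper′ : ProperColouring c′
    proper′ a b arc@(_ , _ , _ , s) eq =
      let γ        = c (a zero ∷ b)
          bits-eq  = trans (sym (finToFun-funToFin (bits a) γ))
                       (trans (cong (λ i → finToFun i γ) eq) (finToFun-funToFin (bits b) γ))
          on-b     = Decision.bit⁺ (reaches? b γ) (a zero , s zero , refl)
          z , z< , eq′ = Decision.bit⁻ (reaches? a γ) (trans bits-eq on-b)
      in proper (z ∷ a) (a zero ∷ b) (∷-arc z a b z< arc) eq′

  shiftGraph : ∀ K N → Graph (N ^ suc K)
  shiftGraph K N = record
    { _~_      = λ x y → Arc (tuple x) (tuple y) ⊎ Arc (tuple y) (tuple x)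
    ; _~?_     = λ x y → arc? (tuple x) (tuple y) ⊎-dec arc? (tuple y) (tuple x)
    ; ~-sym    = λ { (inj₁ e) → inj₂ e ; (inj₂ e) → inj₁ e }
    ; ~-irrefl = λ { refl (inj₁ (_ , _ , _ , s)) → <-irrefl refl (s zero)
                   ; refl (inj₂ (_ , _ , _ , s)) → <-irrefl refl (s zero) }
    }
    where
    tuple : Fin (N ^ suc K) → Fin (suc K) → Fin N
    tuple = finToFun

  shiftGraph-uncolourable : ∀ K {n N} → tower K n < N → ¬ Colourable n (shiftGraph K N)
  shiftGraph-uncolourable K t<N (c , proper) = uncolourable K t<N (c ∘ funToFin)
    λ a b arc → proper (funToFin a) (funToFin b)
      (inj₁ (arc-resp (sym ∘ finToFun-funToFin a) (sym ∘ finToFun-funToFin b) arc))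

  -- Along a walk of at most M steps the middle entry of a (2M + 1)-tuple stays
  -- inside the tuple, moving by one position per step.
  module OddGirth (M N : ℕ) where
    K : ℕ
    K = M + M

    G : Graph (N ^ suc K)
    G = shiftGraph K N

    open Graph G using (_~_)

    tuple : Fin (N ^ suc K) → Fin (suc K) → Fin N
    tuple = finToFun

    record At (val : Fin N) (t : ℕ) (x : Fin (N ^ suc K)) : Set where
      constructor at
      field
        pos  : Fin (suc K)
        low  : M ≤ toℕ pos + t
        high : toℕ pos ≤ M + t
        even : 2 ∣ toℕ pos + t + M
        here : tuple x pos ≡ val

    move : ∀ {val t x y} → suc t ≤ M → x ~ y → At val t x → At val (suc t) y
    move {t = t} t<M (inj₁ _) (at zero low _ _ _) = contradiction low (<⇒≱ t<M)
    move {val} {t} {x} {y} t<M (inj₁ (_ , _ , r , _)) (at (suc p) low high even here) =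
      at (Fin.inject₁ p)
         (subst (λ q → M ≤ q + suc t) (sym eq) (≤-trans low (≤-reflexive (sym (+-suc (toℕ p) t)))))
         (subst (_≤ M + suc t) (sym eq)
           (≤-trans (n≤1+n _) (≤-trans high (+-monoʳ-≤ M (n≤1+n t)))))
         (subst (λ q → 2 ∣ q + suc t + M) (sym eq)
           (subst (λ q → 2 ∣ q + M) (sym (+-suc (toℕ p) t)) even))
         (trans (sym (r (suc p) (Fin.inject₁ p) (cong suc (sym eq)))) here)
      where
      eq : toℕ (Fin.inject₁ p) ≡ toℕ p
      eq = Fin.toℕ-inject₁ p
    move {val} {t} {x} {y} t<M (inj₂ (_ , _ , r , _)) (at p low high even here) =
      at p⁺
         (subst (λ q → M ≤ q + suc t) (sym eq) (≤-trans low (+-mono-≤ (n≤1+n _) (n≤1+n t))))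
         (subst (_≤ M + suc t) (sym eq) (≤-trans (s≤s high) (≤-reflexive (sym (+-suc M t)))))
         (subst (λ q → 2 ∣ q + suc t + M) (sym eq)
           (subst (2 ∣_) (shuffle (toℕ p) t M) (∣m∣n⇒∣m+n (∣-refl {2}) even)))
         (trans (r p⁺ p eq) here)
      where
      bound : suc (toℕ p) < suc K
      bound = s≤s (≤-trans (s≤s high)
        (≤-trans (≤-reflexive (sym (+-suc M t))) (+-monoʳ-≤ M t<M)))
      p⁺ : Fin (suc K)
      p⁺ = fromℕ< bound
      eq : toℕ p⁺ ≡ suc (toℕ p)
      eq = toℕ-fromℕ< bound
      shuffle : ∀ p t M → 2 + (p + t + M) ≡ suc p + suc t + M
      shuffle = solve-∀

    increasing : ∀ {x y} → x ~ y → Increasing (tuple x)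
    increasing (inj₁ (p , _)) = p
    increasing (inj₂ (_ , p , _)) = p

    increasing⇒injective : ∀ {a : Fin (suc K) → Fin N} → Increasing a →
                           ∀ i j → a i ≡ a j → i ≡ j
    increasing⇒injective inc i j eq with Fin.<-cmp i j
    ... | tri< i<j _ _ = contradiction (cong toℕ eq) (<⇒≢ (inc i j i<j))
    ... | tri≈ _ i≡j _ = i≡j
    ... | tri> _ _ j<i = contradiction (cong toℕ (sym eq)) (<⇒≢ (inc j i j<i))

    middle : Fin (suc K)
    middle = fromℕ< (s≤s (m≤m+n M M))

    middle-eq : toℕ middle ≡ M
    middle-eq = toℕ-fromℕ< (s≤s (m≤m+n M M))

    noOddCycle : ∀ ℓ → ℓ ≤ M → ¬ 2 ∣ ℓ → ¬ Cycle G ℓ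
    noOddCycle (suc ℓ) ℓ≤M odd C = odd (∣m+n∣m⇒∣n even′ (divides M (m+m≡m*2 M)))
      where
      open Cycle C

      m+m≡m*2 : ∀ m → m + m ≡ m * 2
      m+m≡m*2 = solve-∀

      x₀ = vertex zero
      val = tuple x₀ middle

      walk : ∀ t (t<ℓ : t < suc ℓ) → At val t (vertex (fromℕ< t<ℓ))
      walk zero    z<s  = at middle
        (subst (λ q → M ≤ q + 0) (sym middle-eq) (m≤m+n M 0))
        (subst (_≤ M + 0) (sym middle-eq) (m≤m+n M 0))
        (subst (λ q → 2 ∣ q + 0 + M) (sym middle-eq)
          (divides M (trans (cong (_+ M) (+-identityʳ M)) (m+m≡m*2 M))))
        refl
      walk (suc t) t<ℓ = move (≤-trans (<⇒≤ t<ℓ) ℓ≤M)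
        (step (fromℕ< t<ℓ′) (fromℕ< t<ℓ)
          (trans (toℕ-fromℕ< t<ℓ) (cong suc (sym (toℕ-fromℕ< t<ℓ′)))))
        (walk t t<ℓ′)
        where
        t<ℓ′ : t < suc ℓ
        t<ℓ′ = <-trans (n<1+n t) t<ℓ

      last : Fin (suc ℓ)
      last = fromℕ< (n<1+n ℓ)

      back : vertex last ~ x₀
      back = closed last zero (cong suc (toℕ-fromℕ< (n<1+n ℓ))) refl

      end : At val (suc ℓ) x₀
      end = move ℓ≤M back (walk ℓ (n<1+n ℓ))

      open At end

      pos≡M : toℕ pos ≡ M
      pos≡M = trans
        (cong toℕ (increasing⇒injective (increasing (~-sym G back)) pos middle here)) middle-eq

      rearrange : ∀ m t → m + t + m ≡ (m + m) + t
      rearrange = solve-∀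

      even′ : 2 ∣ (M + M) + suc ℓ
      even′ = subst (2 ∣_) (trans (cong (λ q → q + suc ℓ + M) pos≡M) (rearrange M (suc ℓ))) even
    noOddCycle zero _ _ C with () ← Cycle.3≤ℓ C

module Existence where

  largest : ∀ {a} {P : ℕ → Set a} → (∀ m → Dec (P m)) →
            P 0 → ∀ u → (∀ m → P m → m ≤ u) → ∃ (IsMaximum P)
  largest P? P0 zero    bound = 0 , P0 , bound
  largest P? P0 (suc u) bound with P? (suc u)
  ... | yes p = suc u , p , bound
  ... | no ¬p = largest P? P0 u λ m p →
    ≤-pred (≤∧≢⇒< (bound m p) λ { refl → ¬p p })

  maximum : ∀ n k → ∃ (IsMaximum (ColourableUpTo n k))
  maximum n k = largest (Decision.colourableUpTo? n k) empty order bound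
    where
    M = 2 * k ∸ 1
    K = M + M
    N = suc (Shift.tower K n)
    order = N ^ suc K

    empty : ColourableUpTo n k 0
    empty zero _ G _ = (λ ()) , λ ()

    bound : ∀ m → ColourableUpTo n k m → m ≤ order
    bound m h with ≤-total m order
    ... | inj₁ m≤ = m≤
    ... | inj₂ ≤m = contradiction
      (h order ≤m (Shift.shiftGraph K N) (Shift.OddGirth.noOddCycle M N))
      (Shift.shiftGraph-uncolourable K ≤-refl)

-- f is abstract, so it is characterised by f-isMaximum alone.
abstract
  f : ℕ → ℕ → ℕ
  f n k = proj₁ (Existence.maximum n k)

  f-isMaximum : ∀ n k → IsMaximum (ColourableUpTo n k) (f n k)
  f-isMaximum n k = proj₂ (Existence.maximum n k)

{-# OPTIONS --safe #-}
-- Write k = K + 1. For n ≥ 2 the claimed bounds for n - 1 and n differ by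
-- K n + 1, and the proof is by induction on n and on the number of vertices.
-- Take the spheres around a vertex x. Those of radius at most K are
-- independent, since otherwise there is a closed walk of odd length at most
-- 2 k - 1. If for some 1 ≤ i ≤ K the sphere of radius i has fewer than n
-- vertices, colour everything but the ball of radius i - 1 in n colours; some
-- colour is missing on the sphere of radius i, so the ball can be coloured
-- layer by layer, alternating this colour with another one. Otherwise the ball
-- of radius K has at least K n + 1 vertices; the rest is coloured in n - 1
-- colours, and the ball is coloured alternately with the new colour outermost.
module Submission where

open import Defs
open import Data.Fin.Base as Fin using (Fin; zero; suc; toℕ)
open import Data.Fin.Properties as Fin using (any?; toℕ<n)
open import Data.Fin.Subset
  using (Subset; Nonempty; inside; outside; _∈_; _∉_; _⊆_; _∩_; _∪_; _─_; _-_; ⁅_⁆; ∣_∣)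
  renaming (⊤ to full)
open import Data.Fin.Subset.Properties
open import Data.Nat using (ℕ; _+_; _*_; _∸_; _/_; _≥_; zero; suc; _≤_; _<_; _<?_; z≤n; s≤s; z<s)
open import Data.Nat.Divisibility using (_∣_; _∣?_; divides; ∣m+n∣m⇒∣n; ∣m∣n⇒∣m+n; ∣1⇒≡1)
open import Data.Nat.DivMod using (m*n/n≡m)
open import Data.Nat.Induction using (<-wellFounded)
open import Data.Nat.Properties
open import Data.Nat.Tactic.RingSolver using (solve-∀)
open import Data.Product.Base using (∃; _×_; _,_; proj₁; proj₂)
open import Data.Sum.Base using (inj₁; inj₂)
open import Data.Vec.Base using ([]; _∷_; here; there; tabulate)
open import Data.Vec.Properties using ([]=⇒lookup; lookup⇒[]=; lookup∘tabulate)
open import Function.Base using (_∘_; id)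
open import Induction.WellFounded using (Acc; acc)
open import Relation.Binary.Definitions using (tri<; tri≈; tri>)
open import Relation.Binary.PropositionalEquality
  using (_≡_; _≢_; refl; sym; trans; cong; subst)
open import Relation.Nullary using (¬_; Dec; yes; no; does; contradiction)
open import Relation.Nullary.Decidable using (_×-dec_; dec-true)

-- Subsets of a finite set, their sizes, and the colours missing on them.

comprehension : ∀ {v} {P : Fin v → Set} → (∀ y → Dec (P y)) → Subset v
comprehension P? = tabulate (does ∘ P?)

∈-comprehension⁺ : ∀ {v} {P : Fin v → Set} (P? : ∀ y → Dec (P y)) {y} →
                   P y → y ∈ comprehension P?
∈-comprehension⁺ P? {y} p =
  lookup⇒[]= y _ (trans (lookup∘tabulate (does ∘ P?) y) (dec-true (P? y) p))

∈-comprehension⁻ : ∀ {v} {P : Fin v → Set} (P? : ∀ y → Dec (P y)) {y} →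
                   y ∈ comprehension P? → P y
∈-comprehension⁻ P? {y} y∈
  with P? y | trans (sym (lookup∘tabulate (does ∘ P?) y)) ([]=⇒lookup y∈)
... | yes p | _ = p
... | no _  | ()

∣p─q∣+∣q∣≡∣p∪q∣ : ∀ {n} (p q : Subset n) → ∣ p ─ q ∣ + ∣ q ∣ ≡ ∣ p ∪ q ∣
∣p─q∣+∣q∣≡∣p∪q∣ []            []            = refl
∣p─q∣+∣q∣≡∣p∪q∣ (inside  ∷ p) (outside ∷ q) = cong suc (∣p─q∣+∣q∣≡∣p∪q∣ p q)
∣p─q∣+∣q∣≡∣p∪q∣ (outside ∷ p) (outside ∷ q) = ∣p─q∣+∣q∣≡∣p∪q∣ p q
∣p─q∣+∣q∣≡∣p∪q∣ (inside  ∷ p) (inside  ∷ q) =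
  trans (+-suc _ _) (cong suc (∣p─q∣+∣q∣≡∣p∪q∣ p q))
∣p─q∣+∣q∣≡∣p∪q∣ (outside ∷ p) (inside  ∷ q) =
  trans (+-suc _ _) (cong suc (∣p─q∣+∣q∣≡∣p∪q∣ p q))

q⊆p⇒∣p─q∣+∣q∣≤∣p∣ : ∀ {n} {p q : Subset n} → q ⊆ p → ∣ p ─ q ∣ + ∣ q ∣ ≤ ∣ p ∣
q⊆p⇒∣p─q∣+∣q∣≤∣p∣ {p = p} {q} q⊆p =
  ≤-trans (≤-reflexive (∣p─q∣+∣q∣≡∣p∪q∣ p q)) (p⊆q⇒∣p∣≤∣q∣ p∪q⊆p)
  where
  p∪q⊆p : p ∪ q ⊆ p
  p∪q⊆p x∈ with x∈p∪q⁻ p q x∈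
  ... | inj₁ x∈p = x∈p
  ... | inj₂ x∈q = q⊆p x∈q

∣p∣≤1+∣p-x∣ : ∀ {n} (p : Subset n) x → ∣ p ∣ ≤ suc ∣ p - x ∣
∣p∣≤1+∣p-x∣ p x = begin
  ∣ p ∣                     ≤⟨ ∣p∣≤∣p∪q∣ p ⁅ x ⁆ ⟩
  ∣ p ∪ ⁅ x ⁆ ∣             ≡⟨ ∣p─q∣+∣q∣≡∣p∪q∣ p ⁅ x ⁆ ⟨
  ∣ p - x ∣ + ∣ ⁅ x ⁆ ∣     ≡⟨ cong (∣ p - x ∣ +_) (∣⁅x⁆∣≡1 x) ⟩
  ∣ p - x ∣ + 1             ≡⟨ +-comm _ 1 ⟩
  suc ∣ p - x ∣             ∎
  where open ≤-Reasoning

x∈p─q⇒x∉q : ∀ {n} {x : Fin n} (p q : Subset n) → x ∈ p ─ q → x ∉ q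
x∈p─q⇒x∉q (_ ∷ p) (_ ∷ q) (there x∈) (there x∈q) = x∈p─q⇒x∉q p q x∈ x∈q
x∈p─q⇒x∉q (_ ∷ p) (inside ∷ q) () here

0<∣p∣⇒Nonempty : ∀ {n} (p : Subset n) → 0 < ∣ p ∣ → Nonempty p
0<∣p∣⇒Nonempty {n} p 0<∣p∣ with nonempty? p
... | yes ne = ne
... | no  e  = contradiction (trans (cong ∣_∣ (Empty-unique e)) (∣⊥∣≡0 n)) (>⇒≢ 0<∣p∣)

-- Start from all `n` colours and delete the colour of each member of `T`: every deletion costs at
-- most one colour. The additive form of the inequality avoids truncated subtraction.
colours-off : ∀ {v n} (c : Fin v → Fin n) (T : Subset v) →
              ∃ λ (U : Subset n) → n ≤ ∣ U ∣ + ∣ T ∣ × (∀ {y} → y ∈ T → c y ∉ U)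
colours-off {n = n} c [] =
  full , ≤-reflexive (sym (trans (+-identityʳ _) (∣⊤∣≡n n))) , λ ()
colours-off c (outside ∷ T) with U , n≤ , off ← colours-off (c ∘ suc) T =
  U , n≤ , λ { (there y∈) → off y∈ }
colours-off c (inside ∷ T) with U , n≤ , off ← colours-off (c ∘ suc) T =
    U - c zero
  , ≤-trans n≤ (≤-trans (+-monoˡ-≤ ∣ T ∣ (∣p∣≤1+∣p-x∣ U (c zero)))
                        (≤-reflexive (sym (+-suc _ ∣ T ∣))))
  , λ { here       c∈ → x∈p─q⇒x∉q U ⁅ c zero ⁆ c∈ (x∈⁅x⁆ _)
      ; (there y∈) c∈ → off y∈ (p─q⊆p U ⁅ c zero ⁆ c∈) }

unused-colour : ∀ {v n} (c : Fin v → Fin n) (T : Subset v) → ∣ T ∣ < n →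
                ∃ λ a → ∀ {y} → y ∈ T → c y ≢ a
unused-colour c T ∣T∣<n with U , n≤ , off ← colours-off c T
  with a , a∈U ← 0<∣p∣⇒Nonempty U (+-cancelʳ-< _ 0 _ (<-≤-trans ∣T∣<n n≤)) =
  a , λ { y∈ refl → off y∈ a∈U }

another : ∀ {n} (a : Fin (suc (suc n))) → ∃ λ b → b ≢ a
another zero    = suc zero , λ ()
another (suc _) = zero , λ ()

-- Walks, and the absence of short odd closed walks.

module Walks {v} (G : Graph v) where
  open Graph G

  infixr 5 _∷_ _++_

  data Walk : Fin v → Fin v → ℕ → Set where
    []  : ∀ {x} → Walk x x 0
    _∷_ : ∀ {x y z n} → x ~ y → Walk y z n → Walk x z (suc n)

  _++_ : ∀ {x y z m n} → Walk x y m → Walk y z n → Walk x z (m + n)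
  []      ++ w′ = w′
  (e ∷ w) ++ w′ = e ∷ (w ++ w′)

  reverse : ∀ {x y n} → Walk x y n → Walk y x n
  reverse [] = []
  reverse {n = suc n} (e ∷ w) =
    subst (Walk _ _) (+-comm n 1) (reverse w ++ (~-sym e ∷ []))

  at : ∀ {x y n} → Walk x y n → ℕ → Fin v
  at {x} _       zero    = x
  -- Past its end a walk is taken to stay at its last vertex, which makes `at` total.
  at {x} []      (suc i) = x
  at     (e ∷ w) (suc i) = at w i

  at-end : ∀ {x y n} (w : Walk x y n) → at w n ≡ y
  at-end []      = refl
  at-end (e ∷ w) = at-end w

  at-step : ∀ {x y n} (w : Walk x y n) i → i < n → at w i ~ at w (suc i)
  at-step (e ∷ [])     zero    _         = e
  at-step (e ∷ _ ∷ _)  zero    _         = e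
  at-step (e ∷ w)      (suc i) (s≤s i<n) = at-step w i i<n

  segment : ∀ {x y n} (w : Walk x y n) {i j} d → i + d ≡ j → j ≤ n →
            Walk (at w i) (at w j) d
  segment w {i} zero    refl _ rewrite +-identityʳ i = []
  segment w {i} (suc d) refl j≤n =
    at-step w i (≤-trans (m<m+n i z<s) j≤n)
    ∷ segment w d (sym (+-suc i d)) j≤n

  module _ (M : ℕ) (noc : ∀ ℓ → ℓ ≤ M → ¬ 2 ∣ ℓ → ¬ Cycle G ℓ) where

    -- A repeated vertex splits a closed walk into two shorter ones, one of
    -- which has odd length if the whole walk has.
    noOddClosedWalk : ∀ {L} → Acc _<_ L → L ≤ M → ¬ 2 ∣ L → ∀ {x} → ¬ Walk x x L
    noOddClosedWalk {L} (acc rec) L≤M odd {x} w = noc L L≤M odd record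
      { 3≤ℓ       = long L odd w
      ; vertex    = at w ∘ toℕ
      ; injective = injective _ _
      ; step      = λ i j eq → subst (λ t → at w (toℕ i) ~ at w t) (sym eq)
                      (at-step w (toℕ i) (toℕ<n i))
      ; closed    = close
      }
      where
      long : ∀ L → ¬ 2 ∣ L → Walk x x L → 3 ≤ L
      long 0 odd _ = contradiction (divides 0 refl) odd
      long 1 odd (e ∷ []) = contradiction e (~-irrefl refl)
      long 2 odd _ = contradiction (divides 1 refl) odd
      long (suc (suc (suc _))) _ _ = s≤s (s≤s (s≤s z≤n))

      close : ∀ (i j : Fin L) → suc (toℕ i) ≡ L → toℕ j ≡ 0 → at w (toℕ i) ~ at w (toℕ j)
      close i j eq eq′ = subst (at w (toℕ i) ~_)
        (trans (cong (at w) eq) (trans (at-end w) (cong (at w) (sym eq′))))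
        (at-step w (toℕ i) (toℕ<n i))

      distinct : ∀ {i j} → i < j → j < L → at w i ≢ at w j
      distinct {i} {j} i<j j<L eq with 2 ∣? j ∸ i
      ... | no odd′ = noOddClosedWalk (rec d<L) (≤-trans (<⇒≤ d<L) L≤M) odd′
              (subst (λ y → Walk y (at w j) (j ∸ i)) eq
                (segment w (j ∸ i) (m+[n∸m]≡n (<⇒≤ i<j)) (<⇒≤ j<L)))
        where
        d<L : j ∸ i < L
        d<L = ≤-<-trans (m∸n≤m j i) j<L
      -- Cutting out the even segment from `i` to `j` preserves the parity of the length and, as
      -- `i < j`, shortens the walk.
      ... | yes even = noOddClosedWalk (rec r<L) (≤-trans (<⇒≤ r<L) L≤M)
              (λ even′ → odd (subst (2 ∣_) total (∣m∣n⇒∣m+n even even′)))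
              (front ++ back)
        where
        total : j ∸ i + (i + (L ∸ j)) ≡ L
        total = trans (sym (+-assoc (j ∸ i) i (L ∸ j)))
          (trans (cong (_+ (L ∸ j)) (m∸n+n≡m (<⇒≤ i<j))) (m+[n∸m]≡n (<⇒≤ j<L)))
        r<L : i + (L ∸ j) < L
        r<L = subst (i + (L ∸ j) <_) total (m<n+m _ (m<n⇒0<n∸m i<j))
        front : Walk x (at w j) i
        front = subst (λ y → Walk x y i) eq (segment w i refl (<⇒≤ (<-trans i<j j<L)))
        back : Walk (at w j) x (L ∸ j)
        back = subst (λ y → Walk (at w j) y (L ∸ j)) (at-end w)
          (segment w (L ∸ j) (m+[n∸m]≡n (<⇒≤ j<L)) ≤-refl)

      injective : ∀ i j → at w (toℕ i) ≡ at w (toℕ j) → i ≡ j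
      injective i j eq with Fin.<-cmp i j
      ... | tri< i<j _ _ = contradiction eq (distinct i<j (toℕ<n j))
      ... | tri≈ _ i≡j _ = i≡j
      ... | tri> _ _ j<i = contradiction (sym eq) (distinct j<i (toℕ<n i))

-- Spheres around a vertex, and colouring a ball from the outside in.

module _ {v} (G : Graph v) where
  open Graph G
  open Walks G

  -- A colouring of an induced subgraph is kept as a function on all vertices, so that passing to a
  -- subset changes no types.
  Proper : ∀ {n} → Subset v → (Fin v → Fin n) → Set
  Proper A c = ∀ {y z} → y ∈ A → z ∈ A → y ~ z → c y ≢ c z

  module Layers (A : Subset v) (x : Fin v) where

    neighbour? : ∀ T y → Dec (∃ λ z → z ∈ T × y ~ z)
    neighbour? T y = any? λ z → (z ∈? T) ×-dec (y ~? z)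

    -- layer i is the sphere of radius i around x in G[A], and rest i is A
    -- without the layers of index less than i.
    mutual
      layer : ℕ → Subset v
      layer zero    = ⁅ x ⁆
      layer (suc i) = rest (suc i) ∩ comprehension (neighbour? (layer i))

      rest : ℕ → Subset v
      rest zero    = A
      rest (suc i) = rest i ─ layer i

    layer⇒walk : ∀ i {y} → y ∈ layer i → Walk y x i
    layer⇒walk zero y∈ with refl ← x∈⁅y⁆⇒x≡y x y∈ = []
    layer⇒walk (suc i) y∈
      with z , z∈ , y~z ← ∈-comprehension⁻ (neighbour? (layer i))
                            (proj₂ (x∈p∩q⁻ (rest (suc i)) _ y∈)) =
      y~z ∷ layer⇒walk i z∈

    module _ {K} (noc : NoShortOddCycle (suc K) G) where

      -- The edge `y ~ z` and the two walks of length `i` to `x` form a closed walk of odd length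
      -- `2i + 1`, at most `2K + 1 = 2k - 1`.
      layer-independent : ∀ {i} → i ≤ K → ∀ {y z} → y ∈ layer i → z ∈ layer i → ¬ y ~ z
      layer-independent {i} i≤K y∈ z∈ y~z =
        noOddClosedWalk (2 * suc K ∸ 1) noc (<-wellFounded (suc (i + i))) short odd
          (y~z ∷ (layer⇒walk i z∈ ++ reverse (layer⇒walk i y∈)))
        where
        short : suc (i + i) ≤ K + suc (K + 0)
        short = ≤-trans (s≤s (+-mono-≤ i≤K (≤-trans i≤K (m≤m+n K 0)))) (≤-reflexive (sym (+-suc K _)))
        i+i≡i*2 : ∀ i → i + i ≡ i * 2
        i+i≡i*2 = solve-∀
        odd : ¬ 2 ∣ suc (i + i)
        odd even with ∣1⇒≡1 (∣m+n∣m⇒∣n (subst (2 ∣_) (+-comm 1 (i + i)) even) (divides i (i+i≡i*2 i)))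
        ... | ()

      -- Give all of layer `i` the colour `a`. This layer is independent, and its neighbours further
      -- out in `A` lie in layer `i + 1`, where `a` does not occur. Layer `i` now misses `b`, so the
      -- same step applies to layer `i - 1` with `a` and `b` exchanged.
      extend : ∀ {n} i → i ≤ K → {a b : Fin n} → b ≢ a → (c : Fin v → Fin n) →
               Proper (rest (suc i)) c → (∀ {y} → y ∈ layer (suc i) → c y ≢ a) →
               ∃ λ (c′ : Fin v → Fin n) → Proper A c′
      extend {n} i i≤K {a} {b} b≢a c proper unused = continue i i≤K refl
        where
        recolour : ∀ {y} → Dec (y ∈ layer i) → Fin n
        recolour     (yes _) = a
        recolour {y} (no _)  = c y

        c′ : Fin v → Fin n
        c′ y = recolour (y ∈? layer i)

        off-a : ∀ {y z} → y ∈ layer i → z ∈ rest i → z ∉ layer i → y ~ z → c z ≢ a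
        off-a y∈ z∈ z∉ y~z = unused (x∈p∩q⁺
          ( x∈p∧x∉q⇒x∈p─q z∈ z∉
          , ∈-comprehension⁺ (neighbour? (layer i)) (_ , y∈ , ~-sym y~z)))

        proper′ : Proper (rest i) c′
        proper′ {y} {z} y∈ z∈ y~z with y ∈? layer i | z ∈? layer i
        ... | yes y∈L | yes z∈L = contradiction y~z (layer-independent i≤K y∈L z∈L)
        ... | yes y∈L | no z∉L  = off-a y∈L z∈ z∉L y~z ∘ sym
        ... | no y∉L  | yes z∈L = off-a z∈L y∈ y∉L (~-sym y~z)
        ... | no y∉L  | no z∉L  =
          proper (x∈p∧x∉q⇒x∈p─q y∈ y∉L) (x∈p∧x∉q⇒x∈p─q z∈ z∉L) y~z

        c′≡a : ∀ {y} → y ∈ layer i → c′ y ≡ a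
        c′≡a {y} y∈ with y ∈? layer i
        ... | yes _ = refl
        ... | no y∉ = contradiction y∈ y∉

        -- Splitting a copy `j` of `i` lets both cases share one definition of `c′`. At index 0 the
        -- recoloured set `rest 0` is `A` itself.
        continue : ∀ j → j ≤ K → j ≡ i → ∃ λ (c″ : Fin v → Fin n) → Proper A c″
        continue zero    _   refl = c′ , proper′
        continue (suc j) j<K refl = extend j (<⇒≤ j<K) (b≢a ∘ sym) c′ proper′
          λ y∈ eq → b≢a (trans (sym eq) (c′≡a y∈))

    -- The centre accounts for one vertex and each of the layers 1 to `i` for at least `n` more;
    -- layers are disjoint, since each is taken from what the earlier ones left.
    rest-bound : x ∈ A → ∀ {n} i → (∀ {j} → j < i → n ≤ ∣ layer (suc j) ∣) →
                 ∣ rest (suc i) ∣ + suc (i * n) ≤ ∣ A ∣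
    rest-bound x∈A zero _ = ≤-trans
      (≤-reflexive (cong (∣ rest 1 ∣ +_) (sym (∣⁅x⁆∣≡1 x))))
      (q⊆p⇒∣p─q∣+∣q∣≤∣p∣ λ y∈ → subst (_∈ A) (sym (x∈⁅y⁆⇒x≡y x y∈)) x∈A)
    rest-bound x∈A {n} (suc i) large = begin
      ∣ rest (suc (suc i)) ∣ + suc (n + i * n)
        ≡⟨ shift ∣ rest (suc (suc i)) ∣ n (i * n) ⟩
      ∣ rest (suc (suc i)) ∣ + n + suc (i * n)
        ≤⟨ +-monoˡ-≤ _ (+-monoʳ-≤ ∣ rest (suc (suc i)) ∣ (large (n<1+n i))) ⟩
      ∣ rest (suc (suc i)) ∣ + ∣ layer (suc i) ∣ + suc (i * n)
        ≤⟨ +-monoˡ-≤ _ (q⊆p⇒∣p─q∣+∣q∣≤∣p∣ (p∩q⊆p (rest (suc i)) _)) ⟩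
      ∣ rest (suc i) ∣ + suc (i * n)
        ≤⟨ rest-bound x∈A i (λ j<i → large (m≤n⇒m≤1+n j<i)) ⟩
      ∣ A ∣ ∎
      where
      open ≤-Reasoning
      shift : ∀ r n t → r + suc (n + t) ≡ r + n + suc t
      shift = solve-∀

    rest⊆A : ∀ i → rest i ⊆ A
    rest⊆A zero    = id
    rest⊆A (suc i) = rest⊆A i ∘ p─q⊆p (rest i) (layer i)

    x∉rest : ∀ i → x ∉ rest (suc i)
    x∉rest zero    x∈ = x∈p─q⇒x∉q A ⁅ x ⁆ x∈ (x∈⁅x⁆ x)
    x∉rest (suc i) x∈ = x∉rest i (p─q⊆p (rest (suc i)) _ x∈)

    rest-smaller : x ∈ A → ∀ i → ∣ rest (suc i) ∣ < ∣ A ∣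
    rest-smaller x∈A i = p⊂q⇒∣p∣<∣q∣ (rest⊆A (suc i) , x , x∈A , x∉rest i)

-- The recursive form of the bound.

-- The colour count is m + 1 and k = K + 1.
bound : ℕ → ℕ → ℕ
bound K zero    = 1
bound K (suc m) = bound K m + suc (K * suc (suc m))

-- The increments add up to `s m = 2 + 3 + ... + (m + 1) = m(m + 3)/2`, so the numerator is exactly
-- twice `K * s m` and the division loses nothing.
bound-formula : ∀ K m → suc m + (K * m * (suc m + 2)) / 2 ≡ bound K m
bound-formula K m = trans
  (cong (λ t → suc m + t / 2) (double m))
  (trans (cong (suc m +_) (m*n/n≡m (K * s m) 2)) (sym (closed-form m)))
  where
  s : ℕ → ℕ
  s zero    = 0
  s (suc m) = s m + suc (suc m)

  s-formula : ∀ m → m * (suc m + 2) ≡ s m * 2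
  s-formula zero    = refl
  s-formula (suc m) = trans (regroup m)
    (trans (cong (_+ suc (suc m) * 2) (s-formula m)) (sym (*-distribʳ-+ 2 (s m) (suc (suc m)))))
    where
    regroup : ∀ m → suc m * (suc (suc m) + 2) ≡ m * (suc m + 2) + suc (suc m) * 2
    regroup = solve-∀

  double : ∀ m → K * m * (suc m + 2) ≡ K * s m * 2
  double m = trans (*-assoc K m _) (trans (cong (K *_) (s-formula m)) (sym (*-assoc K (s m) 2)))

  closed-form : ∀ m → bound K m ≡ suc m + K * s m
  closed-form zero    = sym (cong suc (*-zeroʳ K))
  closed-form (suc m) = trans (cong (_+ suc (K * suc (suc m))) (closed-form m)) (regroup m K (s m))
    where
    regroup : ∀ m K t → suc m + K * t + suc (K * suc (suc m)) ≡ suc (suc m) + K * (t + suc (suc m))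
    regroup = solve-∀

-- The double induction.

module _ {v} (G : Graph v) {K} (noc : NoShortOddCycle (suc K) G) where
  open Graph G

  singleton-proper : ∀ {A : Subset v} → ∣ A ∣ ≤ 1 → Proper G {1} A (λ _ → zero)
  singleton-proper {A} ∣A∣≤1 {y} {z} y∈ z∈ y~z _ =
    contradiction ∣A∣≤1 (<⇒≱ (subst (_< ∣ A ∣) (∣⁅x⁆∣≡1 y) (p⊂q⇒∣p∣<∣q∣ {p = ⁅ y ⁆} {q = A}
      ((λ u∈ → subst (_∈ A) (sym (x∈⁅y⁆⇒x≡y y u∈)) y∈)
      , z , z∈ , λ z∈y → ~-irrefl (sym (x∈⁅y⁆⇒x≡y y z∈y)) y~z))))

  Colours : ℕ → Subset v → Set
  Colours n A = ∃ λ (c : Fin v → Fin n) → Proper G A c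

  colour-step : ∀ m (A : Subset v) → ∣ A ∣ ≤ bound K (suc m) →
                (∀ B → ∣ B ∣ ≤ bound K m → Colours (suc m) B) →
                (∀ B → ∣ B ∣ < ∣ A ∣ → Colours (suc (suc m)) B) →
                Colours (suc (suc m)) A
  colour-step m A ∣A∣≤ fewer smaller with nonempty? A
  ... | no  empty     = (λ _ → zero) , λ y∈ → contradiction (_ , y∈) empty
  -- The index `i < K` stands for the radius `i + 1`, so the radii 1 to `K` are searched.
  ... | yes (x , x∈A) with anyUpTo? (λ i → ∣ Layers.layer G A x (suc i) ∣ <? suc (suc m)) K
  ...   | yes (i , i<K , small) =
    let open Layers G A x
        c , proper = smaller (rest (suc i)) (rest-smaller x∈A i)
        a , unused = unused-colour c (layer (suc i)) small
        b , b≢a    = another a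
    in extend noc i (<⇒≤ i<K) b≢a c proper unused
  ...   | no ¬small =
    let open Layers G A x
        large      = λ {j} j<K → ≮⇒≥ λ small → ¬small (j , j<K , small)
        -- The ball has at least `1 + K(m + 2)` vertices, exactly the difference between
        -- `bound K (suc m)` and `bound K m`.
        c , proper = fewer (rest (suc K)) (+-cancelʳ-≤ (suc (K * suc (suc m))) _ _
                       (≤-trans (rest-bound x∈A K large) ∣A∣≤))
    -- Shifting the old colours by `suc` frees colour `zero` outside the ball, in particular on
    -- layer `K + 1`.
    in extend noc K ≤-refl {zero} {suc zero} (λ ()) (suc ∘ c)
         (λ y∈ z∈ y~z → proper y∈ z∈ y~z ∘ Fin.suc-injective) (λ _ ())

  -- Lexicographic recursion on `m` and then the size of `A`: when `m` drops, the set may have any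
  -- size within the new bound, so accessibility starts afresh.
  colour : ∀ m (A : Subset v) → Acc _<_ ∣ A ∣ → ∣ A ∣ ≤ bound K m → Colours (suc m) A
  colour zero    A _         ∣A∣≤ = (λ _ → zero) , singleton-proper ∣A∣≤
  colour (suc m) A (acc rec) ∣A∣≤ = colour-step m A ∣A∣≤
    (λ B → colour m B (<-wellFounded ∣ B ∣))
    (λ B B<A → colour (suc m) B (rec B<A) (≤-trans (<⇒≤ B<A) ∣A∣≤))

colourableUpTo-bound : ∀ m K → ColourableUpTo (suc m) (suc K) (bound K m)
colourableUpTo-bound m K v v≤ G noc
  with c , proper ← colour G noc m full (<-wellFounded _) (subst (_≤ bound K m) (sym (∣⊤∣≡n v)) v≤) =
  c , λ y z → proper ∈⊤ ∈⊤

theorem2 : ∀ (n k : ℕ) → n ≥ 1 → k ≥ 2 →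
    f n k ≥ n + ((k ∸ 1) * (n ∸ 1) * (n + 2)) / 2
theorem2 (suc m) (suc K) _ _ =
  subst (_≤ f (suc m) (suc K)) (sym (bound-formula K m))
    (proj₂ (f-isMaximum (suc m) (suc K)) (bound K m) (colourableUpTo-bound m K))
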